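{- Let $G=(U\cup W,E)$ be a bipartite graph. The number of independent sets of $G$ is given by $$2^{|U|+|W|-|E|}\,R'_2(G;1/2,1).$$
   Context: Graphs are finite and simple. For a bipartite graph $G=(U\cup W,E)$ (with sides $U$ and $W$), $$R'_2(G;\lambda,\mu)=\sum_{S\subseteq E}\lambda^{\mathrm{rk}_2(S)}\mu^{|S|},$$ where $\mathrm{rk}_2(S)$ is the rank over $\mathbb{F}_2$ (the field with two elements) of the bipartite adjacency matrix of the graph $(U\cup W,S)$, i.e. the $|U|\times|W|$ zero-one matrix whose $(u,w)$ entry is $1$ iff $\{u,w\}\in S$. The empty set counts as an independent set. -}

module Defs where

open import Algebra.Bundles using (CommutativeRing)
import Algebra.Definitions.RawSemiring
import Algebra.Properties.Semiring.Sum
open import Data.Bool.Properties using (xor-∧-commutativeRing)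
open import Data.Empty using (⊥)
open import Data.Fin.Base using (Fin; combine; splitAt)
open import Data.Fin.Properties using (all?)
open import Data.Fin.Subset as Subset
  using (Subset; inside; outside; ∣_∣; _∈_; _⊆_)
open import Data.Fin.Subset.Properties using (_∈?_; _⊆?_; anySubset?)
open import Data.Integer.Base using (ℤ; +_; -[1+_])
open import Data.List.Base as List
  using (List; []; _∷_; _++_; foldr; filter; length)
open import Data.List.Extrema.Nat using (max)
open import Data.List.Membership.Propositional using () renaming (_∈_ to _∈ᴸ_)
open import Data.List.Membership.Propositional.Properties
  using (∈-++⁺ˡ; ∈-++⁺ʳ; ∈-map⁺; ∈-map⁻)
open import Data.List.Relation.Binary.Disjoint.Propositional using (Disjoint)
open import Data.List.Relation.Unary.All using ([])
open import Data.List.Relation.Unary.Any using (here)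
open import Data.List.Relation.Unary.AllPairs using ([]; _∷_)
open import Data.List.Relation.Unary.Unique.Propositional using (Unique)
open import Data.List.Relation.Unary.Unique.Propositional.Properties
  using (map⁺; ++⁺)
open import Data.Nat.Base as ℕ using (ℕ; zero; suc)
open import Data.Product.Base using (_,_)
open import Data.Rational.Base as ℚ using (ℚ; 0ℚ; 1/_)
open import Data.Sum.Base using (_⊎_; inj₁; inj₂)
open import Data.Vec.Base using (lookup; []; _∷_)
open import Data.Vec.Properties using (≡-dec; ∷-injectiveʳ)
open import Function.Base using (_∘_)
open import Relation.Binary.PropositionalEquality using (_≡_; refl)
open import Relation.Nullary
  using (Dec; no; ¬_; ¬?; _→-dec_; map′; decidable-stable)
open import Relation.Unary using (Pred; Decidable)
import Data.Bool.Properties as Bool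

open Algebra.Definitions.RawSemiring ℚ.+-*-rawSemiring using (_^_)

private
  variable
    m n : ℕ

subsets : ∀ n → List (Subset n)
subsets zero    = [] ∷ []
subsets (suc n) =
  List.map (outside ∷_) (subsets n) ++ List.map (inside ∷_) (subsets n)

∈-subsets : (p : Subset n) → p ∈ᴸ subsets n
∈-subsets []            = here refl
∈-subsets (outside ∷ p) = ∈-++⁺ˡ (∈-map⁺ (outside ∷_) (∈-subsets p))
∈-subsets (inside  ∷ p) = ∈-++⁺ʳ _ (∈-map⁺ (inside ∷_) (∈-subsets p))

subsets-unique : ∀ n → Unique (subsets n)
subsets-unique zero    = [] ∷ []
subsets-unique (suc n) =
  ++⁺ (map⁺ ∷-injectiveʳ (subsets-unique n))
      (map⁺ ∷-injectiveʳ (subsets-unique n))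
      disjoint
  where
  disjoint : Disjoint (List.map (outside ∷_) (subsets n))
                      (List.map (inside ∷_) (subsets n))
  disjoint (p∈out , p∈in)
    with ∈-map⁻ (outside ∷_) p∈out | ∈-map⁻ (inside ∷_) p∈in
  ... | _ , _ , refl | _ , _ , ()

allSubset? : ∀ {ℓ} {P : Pred (Subset n) ℓ} → Decidable P → Dec (∀ p → P p)
allSubset? P? =
  map′ (λ ¬∃ p → decidable-stable (P? p) (λ ¬Pp → ¬∃ (p , ¬Pp)))
       (λ ∀P (p , ¬Pp) → ¬Pp (∀P p))
       (¬? (anySubset? (¬? ∘ P?)))

-- The field with two elements: addition is xor, multiplication is ∧.
module 𝔽₂ = CommutativeRing xor-∧-commutativeRing

open Algebra.Properties.Semiring.Sum 𝔽₂.semiring using (sum-syntax)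

Matrix₂ : ℕ → ℕ → Set
Matrix₂ m n = Fin m → Fin n → 𝔽₂.Carrier

infixr 7 _·_

_·_ : Matrix₂ m n → (Fin n → 𝔽₂.Carrier) → Fin m → 𝔽₂.Carrier
_·_ {n = n} M c u = ∑[ w < n ] (M u w 𝔽₂.* c w)

-- A coefficient vector over 𝔽₂ is the same as a subset, namely its
-- support; below c is a coefficient vector supported on J.
LinearlyIndependent : Matrix₂ m n → Subset n → Set
LinearlyIndependent M J =
  ∀ c → c ⊆ J → (∀ u → (M · lookup c) u ≡ 𝔽₂.0#) → c ≡ Subset.⊥

linearlyIndependent? : (M : Matrix₂ m n) → Decidable (LinearlyIndependent M)
linearlyIndependent? M J = allSubset? λ c →
  (c ⊆? J) →-dec
  (all? (λ u → (M · lookup c) u Bool.≟ 𝔽₂.0#) →-dec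
  ≡-dec Bool._≟_ c Subset.⊥)

-- Column rank; the empty set of columns is always independent, so the
-- default value 0 of max is attained.
rk₂ : Matrix₂ m n → ℕ
rk₂ {n = n} M =
  max 0 (List.map ∣_∣ (filter (linearlyIndependent? M) (subsets n)))

-- The sides are U = Fin m and W = Fin n.
-- combine : Fin m → Fin n → Fin (m * n) is the pairing bijection, and
-- combine u w stands for the potential edge {u , w}.
record BipartiteGraph (m n : ℕ) : Set where
  constructor mkBipartiteGraph
  field
    E : Subset (m ℕ.* n)

  Vertex : Set
  Vertex = Fin m ⊎ Fin n

  Adjacent : Vertex → Vertex → Set
  Adjacent (inj₁ u) (inj₂ w) = combine u w ∈ E
  Adjacent (inj₂ w) (inj₁ u) = combine u w ∈ E
  Adjacent (inj₁ _) (inj₁ _) = ⊥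
  Adjacent (inj₂ _) (inj₂ _) = ⊥

  adjacent? : ∀ x y → Dec (Adjacent x y)
  adjacent? (inj₁ u) (inj₂ w) = combine u w ∈? E
  adjacent? (inj₂ w) (inj₁ u) = combine u w ∈? E
  adjacent? (inj₁ _) (inj₁ _) = no λ ()
  adjacent? (inj₂ _) (inj₂ _) = no λ ()

  -- Vertex sets are subsets of Fin (m + n) ↔ Fin m ⊎ Fin n.
  Independent : Subset (m ℕ.+ n) → Set
  Independent I = ∀ x y → x ∈ I → y ∈ I →
                  ¬ Adjacent (splitAt m x) (splitAt m y)

  independent? : Decidable Independent
  independent? I = all? λ x → all? λ y →
    (x ∈? I) →-dec ((y ∈? I) →-dec ¬? (adjacent? (splitAt m x) (splitAt m y)))

  #independentSets : ℕ
  #independentSets = length (filter independent? (subsets (m ℕ.+ n)))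

open BipartiteGraph public

bipartiteAdjacencyMatrix : BipartiteGraph m n → Matrix₂ m n
bipartiteAdjacencyMatrix G u w = lookup (E G) (combine u w)

R′₂ : BipartiteGraph m n → ℚ → ℚ → ℚ
R′₂ {m} {n} G λ′ μ =
  foldr ℚ._+_ 0ℚ (List.map term (filter (_⊆? E G) (subsets (m ℕ.* n))))
  where
  spanningSubgraph : Subset (m ℕ.* n) → BipartiteGraph m n
  spanningSubgraph S = mkBipartiteGraph S

  term : Subset (m ℕ.* n) → ℚ
  term S = λ′ ^ rk₂ (bipartiteAdjacencyMatrix (spanningSubgraph S)) ℚ.* μ ^ ∣ S ∣

infixr 8 _^ℤ_

_^ℤ_ : (p : ℚ) .{{_ : ℚ.NonZero p}} → ℤ → ℚ
p ^ℤ (+ k)    = p ^ k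
p ^ℤ -[1+ k ] = (1/ p) ^ suc k

{-# OPTIONS --safe #-}
module Submission where

-- Write a set S of edges as a zero-one matrix over the field with two elements,
-- with rows indexed by U and columns by W.  By rank-nullity its kernel has
-- 2 ^ (|W| - rk S) elements, so
--
--   2 ^ |W| * R'(G; 1/2, 1)  =  the number of pairs (S , c) with S a subset of
--                               E, c a subset of W, and S c = 0.
--
-- Count these pairs for a fixed c instead.  The condition S c = 0 says that
-- every u in U has an even number of S-neighbours in c, and it can be checked
-- one row at a time.  If u has no G-neighbour in c, all 2 ^ deg u choices of
-- the row of u are allowed; otherwise exactly half of them are, since toggling
-- an edge of G from u to c changes the parity.  On the other hand, the union of
-- c and a subset a of U is independent exactly when every vertex of a is of the
-- first kind; in the count of these a, a vertex of the first kind contributes a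
-- factor 2 and any other vertex of U a factor 1.  Comparing the products,
--
--   2 ^ |U| * #{S : S c = 0}  =  2 ^ |E| * #{a : a and c are not adjacent}
--
-- (#kernelEdgeSets-count), and summing over c gives 2 ^ |E| times the number of
-- independent sets on the right (totalKernel-count).
--
-- Rank-nullity in the form #ker * 2 ^ rk = 2 ^ |W| (rank-nullity) is obtained
-- from a largest independent set J of columns: every vector is congruent modulo
-- the kernel to exactly one vector supported on J (represented and
-- represented-unique), so counting the pairs (k , c) with k in the kernel and
-- k + c supported on J in two ways gives the identity.

open import Defs
open import Data.Fin.Subset using (∣_∣)
open import Data.Integer.Base as ℤ using (+_)
open import Data.Nat.Base as ℕ using (ℕ)
open import Data.Rational.Base as ℚ using (1ℚ; ½)
open import Relation.Binary.PropositionalEquality using (_≡_)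

open import Algebra.Bundles using (CommutativeRing)
import Algebra.Properties.CommutativeSemigroup as CommutativeSemigroup
import Algebra.Properties.Semiring.Exp as Exp
import Algebra.Properties.Semiring.Sum as Sum
open import Data.Bool.Base using (Bool; true; false; if_then_else_; _∧_; _xor_; not)
import Data.Bool.Properties as Bool
open import Data.Fin.Base using (Fin; zero; suc; combine; splitAt; _↑ˡ_; _↑ʳ_)
open import Data.Fin.Properties
  using (all?; splitAt-↑ˡ; splitAt-↑ʳ; splitAt⁻¹-↑ˡ; splitAt⁻¹-↑ʳ)
open import Data.Fin.Subset
  using (Subset; inside; outside; _∈_; _∉_; _⊆_; _∪_; _∩_; ⁅_⁆; ⊥; Nonempty; Empty)
open import Data.Fin.Subset.Properties
import Data.Integer.Properties as ℤ
open import Data.List.Base as List using ([]; _∷_; filter; length)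
open import Data.List.Extrema.Nat using (argmax-sel; xs≤max)
open import Data.List.Membership.Propositional.Properties
  using (∈-filter⁺; ∈-filter⁻; ∈-map⁺; ∈-map⁻)
import Data.List.Properties as List
import Data.List.Relation.Unary.All as All
open import Data.Nat.Base using (zero; suc; _+_; _*_; _^_; _≤_)
import Data.Nat.ListAction as ℕ
import Data.Nat.ListAction.Properties as ℕ
import Data.Nat.Properties as ℕ
open import Data.Product.Base using (∃-syntax; _×_; _,_; proj₁; proj₂)
import Data.Rational.Properties as ℚ
import Data.Rational.Unnormalised.Base as ℚᵘ
import Data.Rational.Unnormalised.Properties as ℚᵘ
open import Data.Sum.Base using (_⊎_; inj₁; inj₂)
open import Data.Vec.Base as Vec using (lookup; zipWith; _++_; []; _∷_; here; there)
open import Data.Vec.Properties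
  using (≡-dec; lookup-zipWith; lookup-++ˡ; lookup-++ʳ; []=⇒lookup; lookup⇒[]=; ∷-injectiveʳ)
open import Function.Base using (_∘_; id)
open import Level using (0ℓ)
open import Relation.Binary.PropositionalEquality
  using (_≢_; refl; sym; trans; cong; cong₂; subst; module ≡-Reasoning)
open import Relation.Nullary
  using (Dec; yes; no; does; ¬_; ¬?; _×-dec_; _→-dec_; contradiction; decidable-stable)
open import Relation.Nullary.Decidable using (dec-true; dec-false)
open import Relation.Unary using (Pred; Decidable)

open Sum 𝔽₂.semiring using (sum-cong-≗; ∑-distrib-+; sum-replicate-zero; sum-syntax)
open ≡-Reasoning

private
  variable
    m n : ℕ
    P Q R : Set

-- Indicators of decidable propositions

-- The indicator: 1 if P holds and 0 otherwise.
𝟙 : Dec P → ℕ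
𝟙 P? = if does P? then 1 else 0

𝟙-yes : (P? : Dec P) → P → 𝟙 P? ≡ 1
𝟙-yes P? p rewrite dec-true P? p = refl

𝟙-no : (P? : Dec P) → ¬ P → 𝟙 P? ≡ 0
𝟙-no P? ¬p rewrite dec-false P? ¬p = refl

𝟙-cong : (P? : Dec P) (Q? : Dec Q) → (P → Q) → (Q → P) → 𝟙 P? ≡ 𝟙 Q?
𝟙-cong (yes p) Q? f g = sym (𝟙-yes Q? (f p))
𝟙-cong (no ¬p) Q? f g = sym (𝟙-no Q? (¬p ∘ g))

𝟙-× : (P? : Dec P) (Q? : Dec Q) (R? : Dec R) →
      (R → P × Q) → (P → Q → R) → 𝟙 R? ≡ 𝟙 P? * 𝟙 Q?
𝟙-× (no ¬p) Q?      R? f g = 𝟙-no R? (¬p ∘ proj₁ ∘ f)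
𝟙-× (yes p) (no ¬q) R? f g = 𝟙-no R? (¬q ∘ proj₂ ∘ f)
𝟙-× (yes p) (yes q) R? f g = 𝟙-yes R? (g p q)

-- Sums over all subsets

-- The sum of f over all subsets of an n-element set, by recursion on n rather than
-- over a list, so that translations and concatenations of subsets are handled by
-- induction.  It agrees with summation over the enumeration (∑ˢ-subsets).
∑ˢ : (Subset n → ℕ) → ℕ
∑ˢ {zero}  f = f []
∑ˢ {suc n} f = ∑ˢ (f ∘ (outside ∷_)) + ∑ˢ (f ∘ (inside ∷_))

∑ˢ-subsets : (f : Subset n → ℕ) → ℕ.sum (List.map f (subsets n)) ≡ ∑ˢ f
∑ˢ-subsets {zero}  f = ℕ.+-identityʳ (f [])
∑ˢ-subsets {suc n} f = begin
  ℕ.sum (List.map f (outs List.++ ins))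
    ≡⟨ cong ℕ.sum (List.map-++ f outs ins) ⟩
  ℕ.sum (List.map f outs List.++ List.map f ins)
    ≡⟨ ℕ.sum-++ (List.map f outs) (List.map f ins) ⟩
  ℕ.sum (List.map f outs) + ℕ.sum (List.map f ins)
    ≡⟨ cong₂ _+_ (half outside) (half inside) ⟩
  ∑ˢ f ∎
  where
  outs = List.map (outside ∷_) (subsets n)
  ins  = List.map (inside ∷_) (subsets n)
  half : ∀ b → ℕ.sum (List.map f (List.map (b ∷_) (subsets n))) ≡ ∑ˢ (f ∘ (b ∷_))
  half b = trans (cong ℕ.sum (sym (List.map-∘ (subsets n)))) (∑ˢ-subsets (f ∘ (b ∷_)))

∑ˢ-cong : {f g : Subset n → ℕ} → (∀ p → f p ≡ g p) → ∑ˢ f ≡ ∑ˢ g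
∑ˢ-cong {zero}  f≗g = f≗g []
∑ˢ-cong {suc n} f≗g = cong₂ _+_ (∑ˢ-cong (f≗g ∘ (outside ∷_))) (∑ˢ-cong (f≗g ∘ (inside ∷_)))

∑ˢ-+ : (f g : Subset n → ℕ) → ∑ˢ (λ p → f p + g p) ≡ ∑ˢ f + ∑ˢ g
∑ˢ-+ {zero}  f g = refl
∑ˢ-+ {suc n} f g = trans
  (cong₂ _+_ (∑ˢ-+ (f ∘ (outside ∷_)) (g ∘ (outside ∷_))) (∑ˢ-+ (f ∘ (inside ∷_)) (g ∘ (inside ∷_))))
  (interchange (∑ˢ (f ∘ (outside ∷_))) (∑ˢ (g ∘ (outside ∷_))) _ _)
  where open CommutativeSemigroup ℕ.+-commutativeSemigroup using (interchange)

∑ˢ-*ˡ : ∀ k (f : Subset n → ℕ) → ∑ˢ (λ p → k * f p) ≡ k * ∑ˢ f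
∑ˢ-*ˡ {zero}  k f = refl
∑ˢ-*ˡ {suc n} k f = trans
  (cong₂ _+_ (∑ˢ-*ˡ k (f ∘ (outside ∷_))) (∑ˢ-*ˡ k (f ∘ (inside ∷_))))
  (sym (ℕ.*-distribˡ-+ k (∑ˢ (f ∘ (outside ∷_))) _))

∑ˢ-*ʳ : ∀ k (f : Subset n → ℕ) → ∑ˢ (λ p → f p * k) ≡ ∑ˢ f * k
∑ˢ-*ʳ k f = begin
  ∑ˢ (λ p → f p * k) ≡⟨ ∑ˢ-cong (λ p → ℕ.*-comm (f p) k) ⟩
  ∑ˢ (λ p → k * f p) ≡⟨ ∑ˢ-*ˡ k f ⟩
  k * ∑ˢ f           ≡⟨ ℕ.*-comm k _ ⟩
  ∑ˢ f * k           ∎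

∑ˢ-comm : (f : Subset m → Subset n → ℕ) →
          ∑ˢ (λ p → ∑ˢ (f p)) ≡ ∑ˢ (λ q → ∑ˢ (λ p → f p q))
∑ˢ-comm {zero}  f = refl
∑ˢ-comm {suc m} f = trans
  (cong₂ _+_ (∑ˢ-comm (f ∘ (outside ∷_))) (∑ˢ-comm (f ∘ (inside ∷_))))
  (sym (∑ˢ-+ (λ q → ∑ˢ (λ p → f (outside ∷ p) q)) _))

∑ˢ-++ : (f : Subset (m + n) → ℕ) → ∑ˢ f ≡ ∑ˢ (λ (p : Subset m) → ∑ˢ (λ q → f (p ++ q)))
∑ˢ-++ {zero}  f = refl
∑ˢ-++ {suc m} f = cong₂ _+_ (∑ˢ-++ {m} (f ∘ (outside ∷_))) (∑ˢ-++ {m} (f ∘ (inside ∷_)))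

∑ˢ-product : (f : Subset m → ℕ) (g : Subset n → ℕ) →
             ∑ˢ (λ p → ∑ˢ (λ q → f p * g q)) ≡ ∑ˢ f * ∑ˢ g
∑ˢ-product f g = trans (∑ˢ-cong (λ p → ∑ˢ-*ˡ (f p) g)) (∑ˢ-*ʳ (∑ˢ g) f)

∑ˢ-1 : ∀ n → ∑ˢ {n} (λ _ → 1) ≡ 2 ^ n
∑ˢ-1 zero    = refl
∑ˢ-1 (suc n) rewrite ∑ˢ-1 n = cong (_+_ (2 ^ n)) (sym (ℕ.+-identityʳ (2 ^ n)))

∑ˢ-𝟙-none : {P : Pred (Subset n) 0ℓ} (P? : Decidable P) →
            (∀ p → ¬ P p) → ∑ˢ (λ p → 𝟙 (P? p)) ≡ 0
∑ˢ-𝟙-none {n} P? ¬P = trans (∑ˢ-cong (λ p → 𝟙-no (P? p) (¬P p))) (∑ˢ-*ˡ {n} 0 (λ _ → 0))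

∑ˢ-𝟙-unique : {P : Pred (Subset n) 0ℓ} (P? : Decidable P) (a : Subset n) →
              P a → (∀ p → P p → p ≡ a) → ∑ˢ (λ p → 𝟙 (P? p)) ≡ 1
∑ˢ-𝟙-unique P? [] Pa unique = 𝟙-yes (P? []) Pa
∑ˢ-𝟙-unique P? (outside ∷ a) Pa unique = cong₂ _+_
  (∑ˢ-𝟙-unique (P? ∘ (outside ∷_)) a Pa (λ p → ∷-injectiveʳ ∘ unique (outside ∷ p)))
  (∑ˢ-𝟙-none (P? ∘ (inside ∷_)) (λ p Pp → contradiction (unique (inside ∷ p) Pp) λ ()))
∑ˢ-𝟙-unique P? (inside ∷ a) Pa unique = cong₂ _+_
  (∑ˢ-𝟙-none (P? ∘ (outside ∷_)) (λ p Pp → contradiction (unique (outside ∷ p) Pp) λ ()))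
  (∑ˢ-𝟙-unique (P? ∘ (inside ∷_)) a Pa (λ p → ∷-injectiveʳ ∘ unique (inside ∷ p)))

∑ˢ-⊆ : (q : Subset n) → ∑ˢ (λ p → 𝟙 (p ⊆? q)) ≡ 2 ^ ∣ q ∣
∑ˢ-⊆ []            = refl
∑ˢ-⊆ {suc n} (outside ∷ q) = trans
  (cong₂ _+_ (∑ˢ-⊆ q)
             (∑ˢ-𝟙-none (λ p → (inside ∷ p) ⊆? (outside ∷ q)) λ p p⊆q → contradiction (p⊆q here) λ ()))
  (ℕ.+-identityʳ _)
∑ˢ-⊆ (inside ∷ q)  = cong₂ _+_ (∑ˢ-⊆ q) (trans (∑ˢ-⊆ q) (sym (ℕ.+-identityʳ _)))

-- Subsets as vectors over the field with two elements

infixl 6 _⊕_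

-- Symmetric difference, that is, addition of vectors over the field with two
-- elements.
_⊕_ : Subset n → Subset n → Subset n
_⊕_ = zipWith _xor_

∈-⊕⁻ : ∀ (p q : Subset n) {x} → x ∈ p ⊕ q → (x ∈ p × x ∉ q) ⊎ (x ∉ p × x ∈ q)
∈-⊕⁻ (true  ∷ p) (false ∷ q) here = inj₁ (here , λ ())
∈-⊕⁻ (false ∷ p) (true  ∷ q) here = inj₂ ((λ ()) , here)
∈-⊕⁻ (_ ∷ p) (_ ∷ q) (there x∈) with ∈-⊕⁻ p q x∈
... | inj₁ (x∈p , x∉q) = inj₁ (there x∈p , λ { (there x∈q) → x∉q x∈q })
... | inj₂ (x∉p , x∈q) = inj₂ ((λ { (there x∈p) → x∉p x∈p }) , there x∈q)

⊕-⊆ : {p q r : Subset n} → p ⊆ r → q ⊆ r → p ⊕ q ⊆ r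
⊕-⊆ {p = p} {q} p⊆r q⊆r x∈ with ∈-⊕⁻ p q x∈
... | inj₁ (x∈p , _) = p⊆r x∈p
... | inj₂ (_ , x∈q) = q⊆r x∈q

⊕-identityˡ : (p : Subset n) → ⊥ ⊕ p ≡ p
⊕-identityˡ []      = refl
⊕-identityˡ (x ∷ p) = cong (x ∷_) (⊕-identityˡ p)

⊕-identityʳ : (p : Subset n) → p ⊕ ⊥ ≡ p
⊕-identityʳ []      = refl
⊕-identityʳ (x ∷ p) = cong₂ _∷_ (𝔽₂.+-identityʳ x) (⊕-identityʳ p)

⊕-self : (p : Subset n) → p ⊕ p ≡ ⊥
⊕-self []      = refl
⊕-self (x ∷ p) = cong₂ _∷_ (Bool.xor-same x) (⊕-self p)

⊕-interchange : (p q r s : Subset n) → (p ⊕ q) ⊕ (r ⊕ s) ≡ (p ⊕ r) ⊕ (q ⊕ s)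
⊕-interchange []      []      []      []      = refl
⊕-interchange (a ∷ p) (b ∷ q) (c ∷ r) (d ∷ s) =
  cong₂ _∷_ (interchange a b c d) (⊕-interchange p q r s)
  where open CommutativeSemigroup 𝔽₂.+-commutativeSemigroup using (interchange)

⊕-⊥⇒≡ : (p q : Subset n) → p ⊕ q ≡ ⊥ → p ≡ q
⊕-⊥⇒≡ p q p⊕q≡⊥ = begin
  p                 ≡⟨ ⊕-identityʳ p ⟨
  p ⊕ ⊥             ≡⟨ cong (p ⊕_) (⊕-self q) ⟨
  p ⊕ (q ⊕ q)       ≡⟨ cong (_⊕ (q ⊕ q)) (⊕-identityˡ p) ⟨
  (⊥ ⊕ p) ⊕ (q ⊕ q) ≡⟨ ⊕-interchange ⊥ p q q ⟩
  (⊥ ⊕ q) ⊕ (p ⊕ q) ≡⟨ cong₂ _⊕_ (⊕-identityˡ q) p⊕q≡⊥ ⟩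
  q ⊕ ⊥             ≡⟨ ⊕-identityʳ q ⟩
  q                 ∎

-- Translation by t permutes the subsets.
∑ˢ-⊕ : ∀ (t : Subset n) f → ∑ˢ (λ p → f (t ⊕ p)) ≡ ∑ˢ f
∑ˢ-⊕ []            f = refl
∑ˢ-⊕ (outside ∷ t) f = cong₂ _+_ (∑ˢ-⊕ t (f ∘ (outside ∷_))) (∑ˢ-⊕ t (f ∘ (inside ∷_)))
∑ˢ-⊕ (inside ∷ t)  f = trans
  (cong₂ _+_ (∑ˢ-⊕ t (f ∘ (inside ∷_))) (∑ˢ-⊕ t (f ∘ (outside ∷_))))
  (ℕ.+-comm (∑ˢ (f ∘ (inside ∷_))) _)

-- The singletons generate the group of subsets under symmetric difference.
⊕-induction : (P : Pred (Subset n) 0ℓ) → P ⊥ → (∀ w → P ⁅ w ⁆) →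
              (∀ {p q} → P p → P q → P (p ⊕ q)) → ∀ p → P p
⊕-induction P P⊥ P⁅⁆ P⊕ [] = P⊥
⊕-induction P P⊥ P⁅⁆ P⊕ (x ∷ p) with x | ⊕-induction (P ∘ (outside ∷_)) P⊥ (P⁅⁆ ∘ suc) P⊕ p
... | outside | Pp = Pp
... | inside  | Pp = subst (P ∘ (inside ∷_)) (⊕-identityˡ p) (P⊕ (P⁅⁆ zero) Pp)

-- The linear functional with coefficients f, evaluated at the indicator vector of p.
-- The entry (M · lookup c) u of a matrix-vector product is ⟨ M u , c ⟩ by definition.
⟨_,_⟩ : (Fin n → Bool) → Subset n → Bool
⟨_,_⟩ {n} f p = ∑[ w < n ] (f w ∧ lookup p w)

⟨⟩-⊕ : ∀ f (p q : Subset n) → ⟨ f , p ⊕ q ⟩ ≡ ⟨ f , p ⟩ xor ⟨ f , q ⟩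
⟨⟩-⊕ f p q = trans
  (sum-cong-≗ (λ w → trans (cong (f w ∧_) (lookup-zipWith _xor_ w p q))
                           (𝔽₂.distribˡ (f w) (lookup p w) (lookup q w))))
  (∑-distrib-+ (λ w → f w ∧ lookup p w) (λ w → f w ∧ lookup q w))

⟨⟩-zero : ∀ f (p : Subset n) → (∀ w → f w ∧ lookup p w ≡ false) → ⟨ f , p ⟩ ≡ false
⟨⟩-zero {n} f p z = trans (sum-cong-≗ z) (sum-replicate-zero n)

⟨⟩-⊥ : ∀ (f : Fin n → Bool) → ⟨ f , ⊥ ⟩ ≡ false
⟨⟩-⊥ {zero}  f = refl
⟨⟩-⊥ {suc n} f = cong₂ _xor_ (Bool.∧-zeroʳ (f zero)) (⟨⟩-⊥ (f ∘ suc))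

⟨⟩-⁅⁆ : ∀ f (w : Fin n) → ⟨ f , ⁅ w ⁆ ⟩ ≡ f w
⟨⟩-⁅⁆ f zero    = trans (cong₂ _xor_ (Bool.∧-identityʳ (f zero)) (⟨⟩-⊥ (f ∘ suc)))
                        (𝔽₂.+-identityʳ (f zero))
⟨⟩-⁅⁆ f (suc w) = trans (cong (_xor ⟨ f ∘ suc , ⁅ w ⁆ ⟩) (Bool.∧-zeroʳ (f zero)))
                        (⟨⟩-⁅⁆ (f ∘ suc) w)

-- The rank-nullity theorem

_≟_ : (p q : Subset n) → Dec (p ≡ q)
_≟_ = ≡-dec Bool._≟_

-- The vectors annihilated by M, encoded by their supports.
Kernel : Matrix₂ m n → Subset n → Set
Kernel M c = ∀ u → (M · lookup c) u ≡ false

kernel? : (M : Matrix₂ m n) → Decidable (Kernel M)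
kernel? M c = all? λ u → (M · lookup c) u Bool.≟ false

#kernel : Matrix₂ m n → ℕ
#kernel M = ∑ˢ (λ c → 𝟙 (kernel? M c))

module _ (M : Matrix₂ m n) where

  kernel-⊥ : Kernel M ⊥
  kernel-⊥ u = ⟨⟩-⊥ (M u)

  kernel-⊕ : ∀ {c d} → Kernel M c → Kernel M d → Kernel M (c ⊕ d)
  kernel-⊕ {c} {d} Kc Kd u = trans (⟨⟩-⊕ (M u) c d) (cong₂ _xor_ (Kc u) (Kd u))

  -- The rank is a maximum with default value 0, which the empty set of columns
  -- attains as well.
  rk₂-attained : ∃[ J ] LinearlyIndependent M J × ∣ J ∣ ≡ rk₂ M
  rk₂-attained
    with argmax-sel id 0 (List.map ∣_∣ (filter (linearlyIndependent? M) (subsets n)))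
  ... | inj₁ rk≡0 = ⊥ , (λ c c⊆⊥ _ → ⊆-antisym c⊆⊥ ⊥⊆) , trans (∣⊥∣≡0 n) (sym rk≡0)
  ... | inj₂ rk∈  with ∈-map⁻ ∣_∣ rk∈
  ...   | J , J∈ , rk≡∣J∣ =
    J , proj₂ (∈-filter⁻ (linearlyIndependent? M) {xs = subsets n} J∈) , sym rk≡∣J∣

  rk₂-maximal : ∀ {J} → LinearlyIndependent M J → ∣ J ∣ ≤ rk₂ M
  rk₂-maximal {J} indep = All.lookup (xs≤max 0 _)
    (∈-map⁺ ∣_∣ (∈-filter⁺ (linearlyIndependent? M) (∈-subsets J) indep))

  -- A constructive form of the negation of linear independence; the search over the
  -- finitely many vectors makes it effective.
  dependent⇒relation : ∀ {J} → ¬ LinearlyIndependent M J →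
                       ∃[ c ] c ⊆ J × Kernel M c × c ≢ ⊥
  dependent⇒relation {J} dep
    with anySubset? (λ c → (c ⊆? J) ×-dec (kernel? M c ×-dec ¬? (c ≟ ⊥)))
  ... | yes relation = relation
  ... | no ¬relation = contradiction indep dep
    where
    indep : LinearlyIndependent M J
    indep c c⊆J Kc =
      decidable-stable (c ≟ ⊥) λ c≢⊥ → ¬relation (c , c⊆J , Kc , c≢⊥)

  module _ {J : Subset n} (indep : LinearlyIndependent M J) (∣J∣≡rk : ∣ J ∣ ≡ rk₂ M) where

    -- The vector c is congruent modulo the kernel to a vector supported on J, where J
    -- is a linearly independent set of columns of maximal size.
    Represented : Subset n → Set
    Represented c = ∃[ k ] Kernel M k × k ⊕ c ⊆ J

    -- For w outside J, adding the column w to J creates a linear relation c by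
    -- maximality; c must involve w because J is independent, so c ⊕ ⁅ w ⁆ is supported
    -- on J.
    represented-⁅⁆ : ∀ w → Represented ⁅ w ⁆
    represented-⁅⁆ w with w ∈? J
    ... | yes w∈J = ⊥ , kernel-⊥ , ⊕-⊆ {p = ⊥} {⁅ w ⁆} ⊥⊆
                      (λ x∈⁅w⁆ → subst (_∈ J) (sym (x∈⁅y⁆⇒x≡y w x∈⁅w⁆)) w∈J)
    ... | no w∉J = c , Kc , c⊕w⊆J
      where
      J∪w = J ∪ ⁅ w ⁆

      w∈J∪w : w ∈ J∪w
      w∈J∪w = q⊆p∪q J ⁅ w ⁆ (x∈⁅x⁆ w)

      dependent : ¬ LinearlyIndependent M J∪w
      dependent indep′ = ℕ.<⇒≱
        (p⊂q⇒∣p∣<∣q∣ (p⊆p∪q ⁅ w ⁆ , w , w∈J∪w , w∉J))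
        (subst (∣ J∪w ∣ ≤_) (sym ∣J∣≡rk) (rk₂-maximal indep′))

      relation = dependent⇒relation dependent
      c = proj₁ relation
      c⊆J∪w = proj₁ (proj₂ relation)
      Kc = proj₁ (proj₂ (proj₂ relation))
      c≢⊥ = proj₂ (proj₂ (proj₂ relation))

      J∪w⁻ : ∀ {x} → x ∈ J∪w → x ≢ w → x ∈ J
      J∪w⁻ x∈ x≢w with x∈p∪q⁻ J ⁅ w ⁆ x∈
      ... | inj₁ x∈J = x∈J
      ... | inj₂ x∈w = contradiction (x∈⁅y⁆⇒x≡y w x∈w) x≢w

      w∈c : w ∈ c
      w∈c with w ∈? c
      ... | yes w∈c = w∈c
      ... | no w∉c = contradiction
        (indep c (λ x∈c → J∪w⁻ (c⊆J∪w x∈c) λ { refl → w∉c x∈c }) Kc) c≢⊥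

      c⊕w⊆J : c ⊕ ⁅ w ⁆ ⊆ J
      c⊕w⊆J x∈ with ∈-⊕⁻ c ⁅ w ⁆ x∈
      ... | inj₁ (x∈c , x∉w) = J∪w⁻ (c⊆J∪w x∈c) (λ { refl → x∉w (x∈⁅x⁆ w) })
      ... | inj₂ (x∉c , x∈w) =
        contradiction (subst (_∈ c) (sym (x∈⁅y⁆⇒x≡y w x∈w)) w∈c) x∉c

    represented : ∀ c → Represented c
    represented = ⊕-induction Represented
      (⊥ , kernel-⊥ , ⊕-⊆ {p = ⊥} {⊥} ⊥⊆ ⊥⊆)
      represented-⁅⁆
      λ {p} {q} (k , Kk , k⊕p⊆J) (l , Kl , l⊕q⊆J) →
        k ⊕ l , kernel-⊕ {k} {l} Kk Kl ,
        subst (_⊆ J) (⊕-interchange k p l q) (⊕-⊆ {p = k ⊕ p} {l ⊕ q} k⊕p⊆J l⊕q⊆J)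

    represented-unique : ∀ c {k l} → Kernel M k → k ⊕ c ⊆ J →
                         Kernel M l → l ⊕ c ⊆ J → k ≡ l
    represented-unique c {k} {l} Kk k⊕c⊆J Kl l⊕c⊆J =
      ⊕-⊥⇒≡ k l (indep (k ⊕ l) k⊕l⊆J (kernel-⊕ {k} {l} Kk Kl))
      where
      cancel : (k ⊕ c) ⊕ (l ⊕ c) ≡ k ⊕ l
      cancel = begin
        (k ⊕ c) ⊕ (l ⊕ c) ≡⟨ ⊕-interchange k c l c ⟩
        (k ⊕ l) ⊕ (c ⊕ c) ≡⟨ cong ((k ⊕ l) ⊕_) (⊕-self c) ⟩
        (k ⊕ l) ⊕ ⊥       ≡⟨ ⊕-identityʳ (k ⊕ l) ⟩
        k ⊕ l             ∎

      k⊕l⊆J : k ⊕ l ⊆ J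
      k⊕l⊆J = subst (_⊆ J) cancel (⊕-⊆ {p = k ⊕ c} {l ⊕ c} k⊕c⊆J l⊕c⊆J)

  -- Double counting of the pairs (k , c) with k in the kernel and k ⊕ c supported on
  -- a maximal independent J: each c has exactly one k, and each k has 2 ^ ∣ J ∣ many c,
  -- namely the translates by k of the subsets of J.
  rank-nullity : #kernel M * 2 ^ rk₂ M ≡ 2 ^ n
  rank-nullity with rk₂-attained
  ... | J , indep , ∣J∣≡rk = sym (begin
    2 ^ n
      ≡⟨ ∑ˢ-1 n ⟨
    ∑ˢ {n} (λ _ → 1)
      ≡⟨ ∑ˢ-cong (λ c → one c (represented indep ∣J∣≡rk c)) ⟨
    ∑ˢ (λ c → ∑ˢ (λ k → 𝟙 (kernel? M k ×-dec (k ⊕ c) ⊆? J)))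
      ≡⟨ ∑ˢ-comm (λ c k → 𝟙 (kernel? M k ×-dec (k ⊕ c) ⊆? J)) ⟩
    ∑ˢ (λ k → ∑ˢ (λ c → 𝟙 (kernel? M k ×-dec (k ⊕ c) ⊆? J)))
      ≡⟨ ∑ˢ-cong column ⟩
    ∑ˢ (λ k → 𝟙 (kernel? M k) * 2 ^ ∣ J ∣)
      ≡⟨ ∑ˢ-*ʳ (2 ^ ∣ J ∣) (λ k → 𝟙 (kernel? M k)) ⟩
    #kernel M * 2 ^ ∣ J ∣
      ≡⟨ cong (λ r → #kernel M * 2 ^ r) ∣J∣≡rk ⟩
    #kernel M * 2 ^ rk₂ M ∎)
    where
    one : ∀ c → Represented indep ∣J∣≡rk c →
          ∑ˢ (λ k → 𝟙 (kernel? M k ×-dec (k ⊕ c) ⊆? J)) ≡ 1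
    one c (k , Kk , k⊕c⊆J) = ∑ˢ-𝟙-unique (λ k → kernel? M k ×-dec (k ⊕ c) ⊆? J)
      k (Kk , k⊕c⊆J)
      (λ l (Kl , l⊕c⊆J) → represented-unique indep ∣J∣≡rk c Kl l⊕c⊆J Kk k⊕c⊆J)

    column : ∀ k → ∑ˢ (λ c → 𝟙 (kernel? M k ×-dec (k ⊕ c) ⊆? J)) ≡
                   𝟙 (kernel? M k) * 2 ^ ∣ J ∣
    column k = begin
      ∑ˢ (λ c → 𝟙 (kernel? M k ×-dec (k ⊕ c) ⊆? J))
        ≡⟨ ∑ˢ-cong (λ c → 𝟙-× (kernel? M k) ((k ⊕ c) ⊆? J)
                                (kernel? M k ×-dec (k ⊕ c) ⊆? J) id _,_) ⟩
      ∑ˢ (λ c → 𝟙 (kernel? M k) * 𝟙 ((k ⊕ c) ⊆? J))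
        ≡⟨ ∑ˢ-*ˡ (𝟙 (kernel? M k)) (λ c → 𝟙 ((k ⊕ c) ⊆? J)) ⟩
      𝟙 (kernel? M k) * ∑ˢ (λ c → 𝟙 ((k ⊕ c) ⊆? J))
        ≡⟨ cong (𝟙 (kernel? M k) *_) (∑ˢ-⊕ k (λ c → 𝟙 (c ⊆? J))) ⟩
      𝟙 (kernel? M k) * ∑ˢ (λ c → 𝟙 (c ⊆? J))
        ≡⟨ cong (𝟙 (kernel? M k) *_) (∑ˢ-⊆ J) ⟩
      𝟙 (kernel? M k) * 2 ^ ∣ J ∣ ∎

-- Subsets of a row orthogonal to a given vector

-- The number of subsets s of e whose intersection with c has parity b, where false
-- stands for even.  In the application e is the neighbourhood of a vertex of U, and s
-- its neighbourhood in a spanning subgraph.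
#subrows : (e c : Subset n) → Bool → ℕ
#subrows e c b = ∑ˢ (λ s → 𝟙 (s ⊆? e) * 𝟙 (⟨ lookup c , s ⟩ Bool.≟ b))

#subrows-total : (e c : Subset n) → #subrows e c false + #subrows e c true ≡ 2 ^ ∣ e ∣
#subrows-total e c = begin
  #subrows e c false + #subrows e c true
    ≡⟨ ∑ˢ-+ (λ s → 𝟙 (s ⊆? e) * 𝟙 (⟨ lookup c , s ⟩ Bool.≟ false)) _ ⟨
  ∑ˢ (λ s → 𝟙 (s ⊆? e) * 𝟙 (⟨ lookup c , s ⟩ Bool.≟ false) +
            𝟙 (s ⊆? e) * 𝟙 (⟨ lookup c , s ⟩ Bool.≟ true))
    ≡⟨ ∑ˢ-cong (λ s → split (𝟙 (s ⊆? e)) ⟨ lookup c , s ⟩) ⟩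
  ∑ˢ (λ s → 𝟙 (s ⊆? e))
    ≡⟨ ∑ˢ-⊆ e ⟩
  2 ^ ∣ e ∣ ∎
  where
  split : ∀ k b → k * 𝟙 (b Bool.≟ false) + k * 𝟙 (b Bool.≟ true) ≡ k
  split k false = trans (cong₂ _+_ (ℕ.*-identityʳ k) (ℕ.*-zeroʳ k)) (ℕ.+-identityʳ k)
  split k true  = cong₂ _+_ (ℕ.*-zeroʳ k) (ℕ.*-identityʳ k)

#subrows-disjoint : (e c : Subset n) → Empty (e ∩ c) → #subrows e c false ≡ 2 ^ ∣ e ∣
#subrows-disjoint e c disjoint = trans
  (∑ˢ-cong λ s → sym (𝟙-× (s ⊆? e) (⟨ lookup c , s ⟩ Bool.≟ false) (s ⊆? e)
    (λ s⊆e → (λ {x} → s⊆e {x}) , ⟨⟩-zero (lookup c) s (zeros s s⊆e)) (λ s⊆e _ → s⊆e)))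
  (∑ˢ-⊆ e)
  where
  zeros : ∀ s → s ⊆ e → ∀ w → lookup c w ∧ lookup s w ≡ false
  zeros s s⊆e w with lookup c w in c≡ | lookup s w in s≡
  ... | false | _     = refl
  ... | true  | false = refl
  ... | true  | true  = contradiction
    (w , x∈p∩q⁺ (s⊆e (lookup⇒[]= w s s≡) , lookup⇒[]= w c c≡)) disjoint

-- If w lies in both e and c, toggling w is an involution on the subsets of e that
-- changes the parity of the intersection with c.
#subrows-balanced : (e c : Subset n) → Nonempty (e ∩ c) →
                    #subrows e c true ≡ #subrows e c false
#subrows-balanced e c (w , w∈e∩c) = trans
  (∑ˢ-cong λ s → cong₂ _*_
    (𝟙-cong (s ⊆? e) ((⁅ w ⁆ ⊕ s) ⊆? e)
      (λ s⊆e → ⊕-⊆ {p = ⁅ w ⁆} {s} w⊆e s⊆e)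
      (λ w⊕s⊆e → subst (_⊆ e) (cancel s) (⊕-⊆ {p = ⁅ w ⁆} {⁅ w ⁆ ⊕ s} w⊆e w⊕s⊆e)))
    (flip s))
  (∑ˢ-⊕ ⁅ w ⁆ (λ s → 𝟙 (s ⊆? e) * 𝟙 (⟨ lookup c , s ⟩ Bool.≟ false)))
  where
  w∈e = proj₁ (x∈p∩q⁻ e c w∈e∩c)
  w∈c = proj₂ (x∈p∩q⁻ e c w∈e∩c)

  w⊆e : ⁅ w ⁆ ⊆ e
  w⊆e x∈w = subst (_∈ e) (sym (x∈⁅y⁆⇒x≡y w x∈w)) w∈e

  cancel : ∀ s → ⁅ w ⁆ ⊕ (⁅ w ⁆ ⊕ s) ≡ s
  cancel s = begin
    ⁅ w ⁆ ⊕ (⁅ w ⁆ ⊕ s)       ≡⟨ cong (_⊕ (⁅ w ⁆ ⊕ s)) (⊕-identityʳ ⁅ w ⁆) ⟨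
    (⁅ w ⁆ ⊕ ⊥) ⊕ (⁅ w ⁆ ⊕ s) ≡⟨ ⊕-interchange ⁅ w ⁆ ⊥ ⁅ w ⁆ s ⟩
    (⁅ w ⁆ ⊕ ⁅ w ⁆) ⊕ (⊥ ⊕ s) ≡⟨ cong₂ _⊕_ (⊕-self ⁅ w ⁆) (⊕-identityˡ s) ⟩
    ⊥ ⊕ s                     ≡⟨ ⊕-identityˡ s ⟩
    s                         ∎

  toggle : ∀ s → ⟨ lookup c , ⁅ w ⁆ ⊕ s ⟩ ≡ not ⟨ lookup c , s ⟩
  toggle s = trans (⟨⟩-⊕ (lookup c) ⁅ w ⁆ s)
    (cong (_xor ⟨ lookup c , s ⟩) (trans (⟨⟩-⁅⁆ (lookup c) w) ([]=⇒lookup w∈c)))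

  flip : ∀ s → 𝟙 (⟨ lookup c , s ⟩ Bool.≟ true) ≡
               𝟙 (⟨ lookup c , ⁅ w ⁆ ⊕ s ⟩ Bool.≟ false)
  flip s rewrite toggle s with ⟨ lookup c , s ⟩
  ... | false = refl
  ... | true  = refl

#subrows-count : (e c : Subset n) →
  2 * #subrows e c false ≡ 2 ^ ∣ e ∣ * (1 + 𝟙 (¬? (nonempty? (e ∩ c))))
#subrows-count e c with nonempty? (e ∩ c)
... | no disjoint = trans (cong (2 *_) (#subrows-disjoint e c disjoint))
                          (ℕ.*-comm 2 (2 ^ ∣ e ∣))
... | yes meets = begin
  2 * #subrows e c false
    ≡⟨ cong (_+_ (#subrows e c false)) (ℕ.+-identityʳ _) ⟩
  #subrows e c false + #subrows e c false
    ≡⟨ cong (_+_ (#subrows e c false)) (#subrows-balanced e c meets) ⟨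
  #subrows e c false + #subrows e c true
    ≡⟨ #subrows-total e c ⟩
  2 ^ ∣ e ∣
    ≡⟨ ℕ.*-identityʳ _ ⟨
  2 ^ ∣ e ∣ * 1 ∎

-- Membership in concatenations

∈-++⁺ˡ : ∀ {p : Subset m} (q : Subset n) {x} → x ∈ p → x ↑ˡ n ∈ p ++ q
∈-++⁺ˡ {p = p} q {x} x∈p = lookup⇒[]= _ _ (trans (lookup-++ˡ p q x) ([]=⇒lookup x∈p))

∈-++⁺ʳ : ∀ (p : Subset m) {q : Subset n} {x} → x ∈ q → m ↑ʳ x ∈ p ++ q
∈-++⁺ʳ p {q} {x} x∈q = lookup⇒[]= _ _ (trans (lookup-++ʳ p q x) ([]=⇒lookup x∈q))

∈-++⁻ˡ : ∀ (p : Subset m) (q : Subset n) {x} → x ↑ˡ n ∈ p ++ q → x ∈ p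
∈-++⁻ˡ p q {x} x∈ = lookup⇒[]= _ _ (trans (sym (lookup-++ˡ p q x)) ([]=⇒lookup x∈))

∈-++⁻ʳ : ∀ (p : Subset m) (q : Subset n) {x} → m ↑ʳ x ∈ p ++ q → x ∈ q
∈-++⁻ʳ p q {x} x∈ = lookup⇒[]= _ _ (trans (sym (lookup-++ʳ p q x)) ([]=⇒lookup x∈))

++-⊆⁺ : {p r : Subset m} {q s : Subset n} → p ⊆ r → q ⊆ s → p ++ q ⊆ r ++ s
++-⊆⁺ {p = []}    {[]}    p⊆r q⊆s x∈        = q⊆s x∈
++-⊆⁺ {p = _ ∷ _} {_ ∷ _} p⊆r q⊆s here with p⊆r here
... | here = here
++-⊆⁺ {p = _ ∷ _} {_ ∷ _} p⊆r q⊆s (there x∈) = there (++-⊆⁺ (drop-∷-⊆ p⊆r) q⊆s x∈)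

++-⊆⁻ : (p r : Subset m) (q s : Subset n) → p ++ q ⊆ r ++ s → p ⊆ r × q ⊆ s
++-⊆⁻ p r q s sub = (λ x∈p → ∈-++⁻ˡ r s (sub (∈-++⁺ˡ q x∈p))) ,
                    (λ x∈q → ∈-++⁻ʳ r s (sub (∈-++⁺ʳ p x∈q)))

∣++∣ : (p : Subset m) (q : Subset n) → ∣ p ++ q ∣ ≡ ∣ p ∣ + ∣ q ∣
∣++∣ []            q = refl
∣++∣ (outside ∷ p) q = ∣++∣ p q
∣++∣ (inside  ∷ p) q = cong suc (∣++∣ p q)

-- Building a graph vertex by vertex

infixr 5 _◂_

-- The graph H with one more vertex in front of the left side, joined to the vertices
-- in s.  The rows of the edge set are consecutive blocks, so this is concatenation.
_◂_ : Subset n → BipartiteGraph m n → BipartiteGraph (suc m) n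
s ◂ H = mkBipartiteGraph (s ++ E H)

module _ (s : Subset n) (H : BipartiteGraph m n) (c : Subset n) where

  ·-zero : (bipartiteAdjacencyMatrix (s ◂ H) · lookup c) zero ≡ ⟨ lookup c , s ⟩
  ·-zero = sum-cong-≗ λ w → trans
    (cong (_∧ lookup c w) (lookup-++ˡ s (E H) w)) (Bool.∧-comm (lookup s w) (lookup c w))

  ·-suc : ∀ u → (bipartiteAdjacencyMatrix (s ◂ H) · lookup c) (suc u) ≡
                (bipartiteAdjacencyMatrix H · lookup c) u
  ·-suc u = sum-cong-≗ λ w → cong (_∧ lookup c w) (lookup-++ʳ s (E H) (combine u w))

  kernel-◂⁺ : ⟨ lookup c , s ⟩ ≡ false → Kernel (bipartiteAdjacencyMatrix H) c →
              Kernel (bipartiteAdjacencyMatrix (s ◂ H)) c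
  kernel-◂⁺ even Kc zero    = trans ·-zero even
  kernel-◂⁺ even Kc (suc u) = trans (·-suc u) (Kc u)

  kernel-◂⁻ : Kernel (bipartiteAdjacencyMatrix (s ◂ H)) c →
              ⟨ lookup c , s ⟩ ≡ false × Kernel (bipartiteAdjacencyMatrix H) c
  kernel-◂⁻ Kc = trans (sym ·-zero) (Kc zero) , λ u → trans (sym (·-suc u)) (Kc (suc u))

-- No edge of G joins a to c, for sets a and c on the left and right side.
NonAdjacent : BipartiteGraph m n → Subset m → Subset n → Set
NonAdjacent G a c = ∀ u w → u ∈ a → w ∈ c → combine u w ∉ E G

nonAdjacent? : ∀ (G : BipartiteGraph m n) a c → Dec (NonAdjacent G a c)
nonAdjacent? G a c = all? λ u → all? λ w →
  (u ∈? a) →-dec ((w ∈? c) →-dec ¬? (combine u w ∈? E G))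

module _ (s : Subset n) (H : BipartiteGraph m n) (a : Subset m) (c : Subset n) where

  nonAdjacent-◂⁻ : ∀ {b} → NonAdjacent (s ◂ H) (b ∷ a) c → NonAdjacent H a c
  nonAdjacent-◂⁻ N u w u∈a w∈c uw∈E = N (suc u) w (there u∈a) w∈c (∈-++⁺ʳ s uw∈E)

  nonAdjacent-in⁻ : NonAdjacent (s ◂ H) (inside ∷ a) c → Empty (s ∩ c)
  nonAdjacent-in⁻ N (w , w∈s∩c) with x∈p∩q⁻ s c w∈s∩c
  ... | w∈s , w∈c = N zero w here w∈c (∈-++⁺ˡ (E H) w∈s)

  nonAdjacent-out⁺ : NonAdjacent H a c → NonAdjacent (s ◂ H) (outside ∷ a) c
  nonAdjacent-out⁺ N (suc u) w (there u∈a) w∈c uw∈ = N u w u∈a w∈c (∈-++⁻ʳ s (E H) uw∈)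

  nonAdjacent-in⁺ : Empty (s ∩ c) → NonAdjacent H a c →
                    NonAdjacent (s ◂ H) (inside ∷ a) c
  nonAdjacent-in⁺ disjoint N zero    w u∈ w∈c uw∈ =
    disjoint (w , x∈p∩q⁺ (∈-++⁻ˡ s (E H) uw∈ , w∈c))
  nonAdjacent-in⁺ disjoint N (suc u) w (there u∈a) w∈c uw∈ =
    N u w u∈a w∈c (∈-++⁻ʳ s (E H) uw∈)

-- The two counts for a fixed set of columns

-- The matrix of a set of edges.  The dimensions are explicit since they cannot be
-- recovered from their product.
matrixOf : ∀ m n → Subset (m * n) → Matrix₂ m n
matrixOf m n S = bipartiteAdjacencyMatrix (mkBipartiteGraph S)

-- The number of sets S of edges of G with c in the kernel of the matrix of S.
#kernelEdgeSets : BipartiteGraph m n → Subset n → ℕ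
#kernelEdgeSets {m} {n} G c = ∑ˢ (λ S → 𝟙 (S ⊆? E G) * 𝟙 (kernel? (matrixOf m n S) c))

-- The number of sets of left vertices with no edge to c.
#nonAdjacentSets : BipartiteGraph m n → Subset n → ℕ
#nonAdjacentSets G c = ∑ˢ (λ a → 𝟙 (nonAdjacent? G a c))

#kernelEdgeSets-◂ : ∀ (e : Subset n) (H : BipartiteGraph m n) c →
  #kernelEdgeSets (e ◂ H) c ≡ #subrows e c false * #kernelEdgeSets H c
#kernelEdgeSets-◂ {n} {m} e H c = begin
  #kernelEdgeSets (e ◂ H) c
    ≡⟨ ∑ˢ-++ {n} (λ S → 𝟙 (S ⊆? (e ++ E H)) * 𝟙 (kernel? (matrixOf (suc m) n S) c)) ⟩
  ∑ˢ (λ (s : Subset n) → ∑ˢ (λ S →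
    𝟙 ((s ++ S) ⊆? (e ++ E H)) * 𝟙 (kernel? (matrixOf (suc m) n (s ++ S)) c)))
    ≡⟨ ∑ˢ-cong (λ s → ∑ˢ-cong (term s)) ⟩
  ∑ˢ (λ s → ∑ˢ (λ S → row s * rest S))
    ≡⟨ ∑ˢ-product row rest ⟩
  #subrows e c false * #kernelEdgeSets H c ∎
  where
  open CommutativeSemigroup ℕ.*-commutativeSemigroup using (interchange)

  row : Subset n → ℕ
  row s = 𝟙 (s ⊆? e) * 𝟙 (⟨ lookup c , s ⟩ Bool.≟ false)

  rest : Subset (m * n) → ℕ
  rest S = 𝟙 (S ⊆? E H) * 𝟙 (kernel? (matrixOf m n S) c)

  term : ∀ s S → 𝟙 ((s ++ S) ⊆? (e ++ E H)) * 𝟙 (kernel? (matrixOf (suc m) n (s ++ S)) c) ≡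
                 row s * rest S
  term s S = trans
    (cong₂ _*_
      (𝟙-× (s ⊆? e) (S ⊆? E H) ((s ++ S) ⊆? (e ++ E H))
           (λ sub → ++-⊆⁻ s e S (E H) sub) (λ s⊆e S⊆E → ++-⊆⁺ {p = s} {e} s⊆e S⊆E))
      (𝟙-× (⟨ lookup c , s ⟩ Bool.≟ false) (kernel? (matrixOf m n S) c)
           (kernel? (matrixOf (suc m) n (s ++ S)) c)
           (kernel-◂⁻ s (mkBipartiteGraph S) c) (kernel-◂⁺ s (mkBipartiteGraph S) c)))
    (interchange (𝟙 (s ⊆? e)) (𝟙 (S ⊆? E H)) _ _)

#nonAdjacentSets-◂ : ∀ (e : Subset n) (H : BipartiteGraph m n) c →
  #nonAdjacentSets (e ◂ H) c ≡
  (1 + 𝟙 (¬? (nonempty? (e ∩ c)))) * #nonAdjacentSets H c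
#nonAdjacentSets-◂ e H c = cong₂ _+_
  (∑ˢ-cong λ a → 𝟙-cong (nonAdjacent? (e ◂ H) (outside ∷ a) c) (nonAdjacent? H a c)
    (nonAdjacent-◂⁻ e H a c) (nonAdjacent-out⁺ e H a c))
  (trans
    (∑ˢ-cong λ a → 𝟙-× (¬? (nonempty? (e ∩ c))) (nonAdjacent? H a c)
      (nonAdjacent? (e ◂ H) (inside ∷ a) c)
      (λ N → nonAdjacent-in⁻ e H a c N , nonAdjacent-◂⁻ e H a c N)
      (nonAdjacent-in⁺ e H a c))
    (∑ˢ-*ˡ (𝟙 (¬? (nonempty? (e ∩ c)))) (λ a → 𝟙 (nonAdjacent? H a c))))

-- The comparison of the two counts, one left vertex at a time: a vertex with
-- neighbourhood e contributes 2 * #subrows e c false on one side and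
-- 2 ^ ∣ e ∣ * (1 + 1) or 2 ^ ∣ e ∣ * (1 + 0) on the other, according to whether e
-- misses c or meets it.
#kernelEdgeSets-count : (G : BipartiteGraph m n) → ∀ c →
  2 ^ m * #kernelEdgeSets G c ≡ 2 ^ ∣ E G ∣ * #nonAdjacentSets G c
#kernelEdgeSets-count {zero}      (mkBipartiteGraph []) c = refl
#kernelEdgeSets-count {suc m} {n} (mkBipartiteGraph E) c with Vec.splitAt n E
... | e , E′ , refl = begin
  2 * 2 ^ m * #kernelEdgeSets (e ◂ H) c
    ≡⟨ cong (2 ^ suc m *_) (#kernelEdgeSets-◂ e H c) ⟩
  2 * 2 ^ m * (#subrows e c false * #kernelEdgeSets H c)
    ≡⟨ interchange 2 (2 ^ m) (#subrows e c false) _ ⟩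
  2 * #subrows e c false * (2 ^ m * #kernelEdgeSets H c)
    ≡⟨ cong₂ _*_ (#subrows-count e c) (#kernelEdgeSets-count H c) ⟩
  2 ^ ∣ e ∣ * (1 + 𝟙 (¬? (nonempty? (e ∩ c)))) * (2 ^ ∣ E′ ∣ * #nonAdjacentSets H c)
    ≡⟨ interchange (2 ^ ∣ e ∣) _ (2 ^ ∣ E′ ∣) _ ⟩
  2 ^ ∣ e ∣ * 2 ^ ∣ E′ ∣ * ((1 + 𝟙 (¬? (nonempty? (e ∩ c)))) * #nonAdjacentSets H c)
    ≡⟨ cong₂ _*_
         (trans (sym (ℕ.^-distribˡ-+-* 2 ∣ e ∣ ∣ E′ ∣)) (cong (2 ^_) (sym (∣++∣ e E′))))
         (sym (#nonAdjacentSets-◂ e H c)) ⟩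
  2 ^ ∣ e ++ E′ ∣ * #nonAdjacentSets (e ◂ H) c ∎
  where
  open CommutativeSemigroup ℕ.*-commutativeSemigroup using (interchange)
  H : BipartiteGraph m n
  H = mkBipartiteGraph E′

-- Independent sets

module _ (G : BipartiteGraph m n) (a : Subset m) (c : Subset n) where

  independent⇒nonAdjacent : Independent G (a ++ c) → NonAdjacent G a c
  independent⇒nonAdjacent indep u w u∈a w∈c uw∈E
    with indep (u ↑ˡ n) (m ↑ʳ w) (∈-++⁺ˡ c u∈a) (∈-++⁺ʳ a w∈c)
  ... | ¬adj rewrite splitAt-↑ˡ m u n | splitAt-↑ʳ m n w = ¬adj uw∈E

  nonAdjacent⇒independent : NonAdjacent G a c → Independent G (a ++ c)
  nonAdjacent⇒independent N x y x∈ y∈ adj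
    with splitAt m x in x≡ | splitAt m y in y≡
  ... | inj₁ u | inj₂ w = N u w
    (∈-++⁻ˡ a c (subst (_∈ a ++ c) (sym (splitAt⁻¹-↑ˡ x≡)) x∈))
    (∈-++⁻ʳ a c (subst (_∈ a ++ c) (sym (splitAt⁻¹-↑ʳ {m} y≡)) y∈)) adj
  ... | inj₂ w | inj₁ u = N u w
    (∈-++⁻ˡ a c (subst (_∈ a ++ c) (sym (splitAt⁻¹-↑ˡ y≡)) y∈))
    (∈-++⁻ʳ a c (subst (_∈ a ++ c) (sym (splitAt⁻¹-↑ʳ {m} x≡)) x∈)) adj

module _ {A : Set} {P : Pred A 0ℓ} (P? : Decidable P) where

  sum-filter : ∀ f xs → ℕ.sum (List.map f (filter P? xs)) ≡
                        ℕ.sum (List.map (λ x → 𝟙 (P? x) * f x) xs)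
  sum-filter f []       = refl
  sum-filter f (x ∷ xs) with P? x
  ... | yes _ = cong₂ _+_ (sym (ℕ.+-identityʳ (f x))) (sum-filter f xs)
  ... | no  _ = sum-filter f xs

  length-filter : ∀ xs → length (filter P? xs) ≡ ℕ.sum (List.map (λ x → 𝟙 (P? x)) xs)
  length-filter []       = refl
  length-filter (x ∷ xs) with P? x
  ... | yes _ = cong suc (length-filter xs)
  ... | no  _ = length-filter xs

#independentSets-∑ : (G : BipartiteGraph m n) →
  #independentSets G ≡ ∑ˢ (λ c → #nonAdjacentSets G c)
#independentSets-∑ {m} {n} G = begin
  #independentSets G
    ≡⟨ length-filter (independent? G) (subsets (m + n)) ⟩
  ℕ.sum (List.map (λ I → 𝟙 (independent? G I)) (subsets (m + n)))
    ≡⟨ ∑ˢ-subsets (λ I → 𝟙 (independent? G I)) ⟩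
  ∑ˢ (λ I → 𝟙 (independent? G I))
    ≡⟨ ∑ˢ-++ {m} _ ⟩
  ∑ˢ (λ (a : Subset m) → ∑ˢ (λ c → 𝟙 (independent? G (a ++ c))))
    ≡⟨ ∑ˢ-comm (λ (a : Subset m) c → 𝟙 (independent? G (a ++ c))) ⟩
  ∑ˢ (λ c → ∑ˢ (λ (a : Subset m) → 𝟙 (independent? G (a ++ c))))
    ≡⟨ ∑ˢ-cong (λ c → ∑ˢ-cong (λ (a : Subset m) →
         𝟙-cong (independent? G (a ++ c)) (nonAdjacent? G a c)
           (independent⇒nonAdjacent G a c) (nonAdjacent⇒independent G a c))) ⟩
  ∑ˢ (λ c → #nonAdjacentSets G c) ∎

-- The number of pairs (S , c) with S a set of edges of G and c in the kernel of
-- the matrix of S.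
totalKernel : BipartiteGraph m n → ℕ
totalKernel {m} {n} G =
  ℕ.sum (List.map (λ S → #kernel (matrixOf m n S)) (filter (_⊆? E G) (subsets (m * n))))

totalKernel-count : (G : BipartiteGraph m n) →
  2 ^ m * totalKernel G ≡ 2 ^ ∣ E G ∣ * #independentSets G
totalKernel-count {m} {n} G = begin
  2 ^ m * totalKernel G
    ≡⟨ cong (2 ^ m *_) (sum-filter (_⊆? E G) (λ S → #kernel (matrixOf m n S)) (subsets (m * n))) ⟩
  2 ^ m * ℕ.sum (List.map (λ S → 𝟙 (S ⊆? E G) * #kernel (matrixOf m n S)) (subsets (m * n)))
    ≡⟨ cong (2 ^ m *_) (∑ˢ-subsets (λ S → 𝟙 (S ⊆? E G) * #kernel (matrixOf m n S))) ⟩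
  2 ^ m * ∑ˢ (λ S → 𝟙 (S ⊆? E G) * #kernel (matrixOf m n S))
    ≡⟨ cong (2 ^ m *_) (∑ˢ-cong (λ S →
         ∑ˢ-*ˡ (𝟙 (S ⊆? E G)) (λ c → 𝟙 (kernel? (matrixOf m n S) c)))) ⟨
  2 ^ m * ∑ˢ (λ S → ∑ˢ (λ c → 𝟙 (S ⊆? E G) * 𝟙 (kernel? (matrixOf m n S) c)))
    ≡⟨ cong (2 ^ m *_) (∑ˢ-comm
         (λ S c → 𝟙 (S ⊆? E G) * 𝟙 (kernel? (matrixOf m n S) c))) ⟩
  2 ^ m * ∑ˢ (λ c → #kernelEdgeSets G c)
    ≡⟨ ∑ˢ-*ˡ (2 ^ m) (λ c → #kernelEdgeSets G c) ⟨
  ∑ˢ (λ c → 2 ^ m * #kernelEdgeSets G c)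
    ≡⟨ ∑ˢ-cong (#kernelEdgeSets-count G) ⟩
  ∑ˢ (λ c → 2 ^ ∣ E G ∣ * #nonAdjacentSets G c)
    ≡⟨ ∑ˢ-*ˡ (2 ^ ∣ E G ∣) (λ c → #nonAdjacentSets G c) ⟩
  2 ^ ∣ E G ∣ * ∑ˢ (λ c → #nonAdjacentSets G c)
    ≡⟨ cong (2 ^ ∣ E G ∣ *_) (#independentSets-∑ G) ⟨
  2 ^ ∣ E G ∣ * #independentSets G ∎

-- Powers of two in the rational numbers

private module ℚ-Ring = CommutativeRing ℚ.+-*-commutativeRing
open Exp ℚ-Ring.semiring using () renaming (_^_ to _^ℚ_; ^-homo-* to ^ℚ-homo-*)

-- The inclusion of the natural numbers in the rational numbers.
toℚ : ℕ → ℚ.ℚ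
toℚ k = + k ℚ./ 1

2ℚ : ℚ.ℚ
2ℚ = + 2 ℚ./ 1

fromℚᵘ-homo-+ : ∀ p q → ℚ.fromℚᵘ (p ℚᵘ.+ q) ≡ ℚ.fromℚᵘ p ℚ.+ ℚ.fromℚᵘ q
fromℚᵘ-homo-+ p q = ℚ.toℚᵘ-injective
  (ℚᵘ.≃-trans (ℚ.toℚᵘ-fromℚᵘ (p ℚᵘ.+ q))
  (ℚᵘ.≃-trans (ℚᵘ.≃-sym (ℚᵘ.+-cong (ℚ.toℚᵘ-fromℚᵘ p) (ℚ.toℚᵘ-fromℚᵘ q)))
              (ℚᵘ.≃-sym (ℚ.toℚᵘ-homo-+ (ℚ.fromℚᵘ p) (ℚ.fromℚᵘ q)))))

fromℚᵘ-homo-* : ∀ p q → ℚ.fromℚᵘ (p ℚᵘ.* q) ≡ ℚ.fromℚᵘ p ℚ.* ℚ.fromℚᵘ q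
fromℚᵘ-homo-* p q = ℚ.toℚᵘ-injective
  (ℚᵘ.≃-trans (ℚ.toℚᵘ-fromℚᵘ (p ℚᵘ.* q))
  (ℚᵘ.≃-trans (ℚᵘ.≃-sym (ℚᵘ.*-cong (ℚ.toℚᵘ-fromℚᵘ p) (ℚ.toℚᵘ-fromℚᵘ q)))
              (ℚᵘ.≃-sym (ℚ.toℚᵘ-homo-* (ℚ.fromℚᵘ p) (ℚ.fromℚᵘ q)))))

toℚ-+ : ∀ j k → toℚ (j + k) ≡ toℚ j ℚ.+ toℚ k
toℚ-+ j k = trans
  (cong (ℚ._/ 1) (trans (ℤ.pos-+ j k)
    (sym (cong₂ ℤ._+_ (ℤ.*-identityʳ (+ j)) (ℤ.*-identityʳ (+ k))))))
  (fromℚᵘ-homo-+ (ℚᵘ.mkℚᵘ (+ j) 0) (ℚᵘ.mkℚᵘ (+ k) 0))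

toℚ-* : ∀ j k → toℚ (j * k) ≡ toℚ j ℚ.* toℚ k
toℚ-* j k = trans (cong (ℚ._/ 1) (ℤ.pos-* j k))
  (fromℚᵘ-homo-* (ℚᵘ.mkℚᵘ (+ j) 0) (ℚᵘ.mkℚᵘ (+ k) 0))

toℚ-2^ : ∀ k → toℚ (2 ^ k) ≡ 2ℚ ^ℚ k
toℚ-2^ zero    = refl
toℚ-2^ (suc k) = trans (toℚ-* 2 (2 ^ k)) (cong (2ℚ ℚ.*_) (toℚ-2^ k))

*-interchange : ∀ p q r s → (p ℚ.* q) ℚ.* (r ℚ.* s) ≡ (p ℚ.* r) ℚ.* (q ℚ.* s)
*-interchange = interchange
  where open CommutativeSemigroup ℚ-Ring.*-commutativeSemigroup using (interchange)

1^ : ∀ k → 1ℚ ^ℚ k ≡ 1ℚ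
1^ zero    = refl
1^ (suc k) = trans (ℚ.*-identityˡ _) (1^ k)

^-inverse : ∀ {p q} → p ℚ.* q ≡ 1ℚ → ∀ k → p ^ℚ k ℚ.* q ^ℚ k ≡ 1ℚ
^-inverse pq≡1 zero    = refl
^-inverse {p} {q} pq≡1 (suc k) = trans (*-interchange p (p ^ℚ k) q (q ^ℚ k))
  (cong₂ ℚ._*_ pq≡1 (^-inverse pq≡1 k))

^ℤ-⊖ : ∀ p .{{_ : ℚ.NonZero p}} j k → p ^ℤ (j ℤ.⊖ k) ℚ.* p ^ℚ k ≡ p ^ℚ j
^ℤ-⊖ p j       zero    = ℚ.*-identityʳ (p ^ℚ j)
^ℤ-⊖ p zero    (suc k) = ^-inverse {ℚ.1/ p} {p} (ℚ.*-inverseˡ p) (suc k)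
^ℤ-⊖ p (suc j) (suc k) = begin
  p ^ℤ (suc j ℤ.⊖ suc k) ℚ.* (p ℚ.* p ^ℚ k)
    ≡⟨ cong (λ i → p ^ℤ i ℚ.* (p ℚ.* p ^ℚ k)) (ℤ.[1+m]⊖[1+n]≡m⊖n j k) ⟩
  p ^ℤ (j ℤ.⊖ k) ℚ.* (p ℚ.* p ^ℚ k)
    ≡⟨ x∙yz≈y∙xz (p ^ℤ (j ℤ.⊖ k)) p (p ^ℚ k) ⟩
  p ℚ.* (p ^ℤ (j ℤ.⊖ k) ℚ.* p ^ℚ k)
    ≡⟨ cong (p ℚ.*_) (^ℤ-⊖ p j k) ⟩
  p ℚ.* p ^ℚ j ∎
  where open CommutativeSemigroup ℚ-Ring.*-commutativeSemigroup using (x∙yz≈y∙xz)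

^ℤ-minus : ∀ p .{{_ : ℚ.NonZero p}} j k → p ^ℤ (+ j ℤ.- + k) ℚ.* p ^ℚ k ≡ p ^ℚ j
^ℤ-minus p j k = trans (cong (λ i → p ^ℤ i ℚ.* p ^ℚ k) (ℤ.m-n≡m⊖n j k)) (^ℤ-⊖ p j k)

invertible-cancelˡ : ∀ {p q r s} → p ℚ.* q ≡ 1ℚ → q ℚ.* r ≡ q ℚ.* s → r ≡ s
invertible-cancelˡ {p} {q} {r} {s} pq≡1 qr≡qs = begin
  r                 ≡⟨ undo r ⟨
  p ℚ.* (q ℚ.* r)   ≡⟨ cong (p ℚ.*_) qr≡qs ⟩
  p ℚ.* (q ℚ.* s)   ≡⟨ undo s ⟩
  s                 ∎
  where
  undo : ∀ t → p ℚ.* (q ℚ.* t) ≡ t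
  undo t = trans (sym (ℚ.*-assoc p q t)) (trans (cong (ℚ._* t) pq≡1) (ℚ.*-identityˡ t))

-- A rational list sum becomes a sum of natural numbers after multiplication by a
-- common factor k that clears the denominators.
scaled-sum : ∀ {A : Set} k (f : A → ℚ.ℚ) (g : A → ℕ) → (∀ x → k ℚ.* f x ≡ toℚ (g x)) →
  ∀ xs → k ℚ.* List.foldr ℚ._+_ ℚ.0ℚ (List.map f xs) ≡ toℚ (ℕ.sum (List.map g xs))
scaled-sum k f g kf≡g []       = ℚ.*-zeroʳ k
scaled-sum k f g kf≡g (x ∷ xs) = begin
  k ℚ.* (f x ℚ.+ List.foldr ℚ._+_ ℚ.0ℚ (List.map f xs))
    ≡⟨ ℚ.*-distribˡ-+ k (f x) _ ⟩
  k ℚ.* f x ℚ.+ k ℚ.* List.foldr ℚ._+_ ℚ.0ℚ (List.map f xs)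
    ≡⟨ cong₂ ℚ._+_ (kf≡g x) (scaled-sum k f g kf≡g xs) ⟩
  toℚ (g x) ℚ.+ toℚ (ℕ.sum (List.map g xs))
    ≡⟨ toℚ-+ (g x) _ ⟨
  toℚ (g x + ℕ.sum (List.map g xs)) ∎

-- The term of R′₂ at λ = 1/2 and μ = 1, multiplied by 2 ^ n, is the size of the
-- kernel.
kernel-weight : (M : Matrix₂ m n) → ∀ k →
  2ℚ ^ℚ n ℚ.* (½ ^ℚ rk₂ M ℚ.* 1ℚ ^ℚ k) ≡ toℚ (#kernel M)
kernel-weight {n = n} M k = begin
  2ℚ ^ℚ n ℚ.* (½ ^ℚ r ℚ.* 1ℚ ^ℚ k)
    ≡⟨ cong₂ ℚ._*_ 2^n (trans (cong (½ ^ℚ r ℚ.*_) (1^ k)) (ℚ.*-identityʳ _)) ⟩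
  (toℚ (#kernel M) ℚ.* 2ℚ ^ℚ r) ℚ.* ½ ^ℚ r
    ≡⟨ ℚ.*-assoc (toℚ (#kernel M)) _ _ ⟩
  toℚ (#kernel M) ℚ.* (2ℚ ^ℚ r ℚ.* ½ ^ℚ r)
    ≡⟨ cong (toℚ (#kernel M) ℚ.*_) (^-inverse {2ℚ} {½} refl r) ⟩
  toℚ (#kernel M) ℚ.* 1ℚ
    ≡⟨ ℚ.*-identityʳ _ ⟩
  toℚ (#kernel M) ∎
  where
  r = rk₂ M
  2^n : 2ℚ ^ℚ n ≡ toℚ (#kernel M) ℚ.* 2ℚ ^ℚ r
  2^n = begin
    2ℚ ^ℚ n                      ≡⟨ toℚ-2^ n ⟨
    toℚ (2 ^ n)                  ≡⟨ cong toℚ (rank-nullity M) ⟨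
    toℚ (#kernel M * 2 ^ r)      ≡⟨ toℚ-* (#kernel M) (2 ^ r) ⟩
    toℚ (#kernel M) ℚ.* toℚ (2 ^ r) ≡⟨ cong (toℚ (#kernel M) ℚ.*_) (toℚ-2^ r) ⟩
    toℚ (#kernel M) ℚ.* 2ℚ ^ℚ r  ∎

R′₂-totalKernel : (G : BipartiteGraph m n) →
  2ℚ ^ℚ n ℚ.* R′₂ G ½ 1ℚ ≡ toℚ (totalKernel G)
R′₂-totalKernel {m} {n} G = scaled-sum (2ℚ ^ℚ n) _ (λ S → #kernel (matrixOf m n S))
  (λ S → kernel-weight (matrixOf m n S) ∣ S ∣) (filter (_⊆? E G) (subsets (m * n)))

theorem1 : (m n : ℕ) (G : BipartiteGraph m n) →
    (+ #independentSets G) ℚ./ 1 ≡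
    (+ 2 ℚ./ 1) ^ℤ (+ (m ℕ.+ n) ℤ.- + ∣ E G ∣) ℚ.* R′₂ G ½ 1ℚ
-- The exponent m + n - ∣ E G ∣ may be negative, so both sides are first multiplied
-- by 2 ^ ∣ E G ∣.
theorem1 m n G = invertible-cancelˡ {½ ^ℚ ∣ E G ∣} {2ℚ ^ℚ ∣ E G ∣}
  (^-inverse {½} {2ℚ} refl ∣ E G ∣) (begin
  2ℚ ^ℚ ∣ E G ∣ ℚ.* toℚ (#independentSets G)
    ≡⟨ cong (ℚ._* toℚ (#independentSets G)) (toℚ-2^ ∣ E G ∣) ⟨
  toℚ (2 ^ ∣ E G ∣) ℚ.* toℚ (#independentSets G)
    ≡⟨ toℚ-* (2 ^ ∣ E G ∣) (#independentSets G) ⟨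
  toℚ (2 ^ ∣ E G ∣ * #independentSets G)
    ≡⟨ cong toℚ (totalKernel-count G) ⟨
  toℚ (2 ^ m * totalKernel G)
    ≡⟨ toℚ-* (2 ^ m) (totalKernel G) ⟩
  toℚ (2 ^ m) ℚ.* toℚ (totalKernel G)
    ≡⟨ cong₂ ℚ._*_ (toℚ-2^ m) (sym (R′₂-totalKernel G)) ⟩
  2ℚ ^ℚ m ℚ.* (2ℚ ^ℚ n ℚ.* R′₂ G ½ 1ℚ)
    ≡⟨ ℚ.*-assoc (2ℚ ^ℚ m) (2ℚ ^ℚ n) _ ⟨
  2ℚ ^ℚ m ℚ.* 2ℚ ^ℚ n ℚ.* R′₂ G ½ 1ℚ
    ≡⟨ cong (ℚ._* R′₂ G ½ 1ℚ) (^ℚ-homo-* 2ℚ m n) ⟨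
  2ℚ ^ℚ (m + n) ℚ.* R′₂ G ½ 1ℚ
    ≡⟨ cong (ℚ._* R′₂ G ½ 1ℚ) (^ℤ-minus 2ℚ (m + n) ∣ E G ∣) ⟨
  z ℚ.* 2ℚ ^ℚ ∣ E G ∣ ℚ.* R′₂ G ½ 1ℚ
    ≡⟨ cong (ℚ._* R′₂ G ½ 1ℚ) (ℚ.*-comm z _) ⟩
  2ℚ ^ℚ ∣ E G ∣ ℚ.* z ℚ.* R′₂ G ½ 1ℚ
    ≡⟨ ℚ.*-assoc (2ℚ ^ℚ ∣ E G ∣) z _ ⟩
  2ℚ ^ℚ ∣ E G ∣ ℚ.* (z ℚ.* R′₂ G ½ 1ℚ) ∎)
  where
  z = 2ℚ ^ℤ (+ (m ℕ.+ n) ℤ.- + ∣ E G ∣)
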